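{- There exists an absolute constant $c>0$ such that the following holds. Let $q$ be a prime, $F=\mathbb{Z}/q\mathbb{Z}$, and let $A$ be a nonempty subset of $F$ with $|A|<|F|^{1/2}$. Then $$|A-A|\cdot|I(A)|\ge c|A|^{5/2}.$$
   Context: For $A\subset F$, $A-A:=\{a-b:a,b\in A\}$ and $$I(A):=\{a_1(a_2-a_3)+a_4(a_5-a_6):a_1,\dots,a_6\in A\}.$$ -}

module Defs where

open import Data.Nat using (ℕ; _+_; _*_; _∸_; NonZero)
open import Data.Nat.DivMod using (_mod_)
open import Data.Fin using (Fin; toℕ)
open import Data.Fin.Subset using (Subset; _∈_)
open import Data.Product using (∃-syntax; _×_)
open import Function.Bundles using (_⇔_)
open import Relation.Binary.PropositionalEquality using (_≡_)

module _ {q : ℕ} .{{_ : NonZero q}} where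

  _+F_ : Fin q → Fin q → Fin q
  a +F b = (toℕ a + toℕ b) mod q

  _-F_ : Fin q → Fin q → Fin q
  a -F b = (toℕ a + (q ∸ toℕ b)) mod q

  _*F_ : Fin q → Fin q → Fin q
  a *F b = (toℕ a * toℕ b) mod q

  infixl 6 _+F_ _-F_
  infixl 7 _*F_

  IsDiffSet : Subset q → Subset q → Set
  IsDiffSet A S =
    ∀ x → (x ∈ S) ⇔ (∃[ a ] ∃[ b ] (a ∈ A × b ∈ A × x ≡ a -F b))

  IsISet : Subset q → Subset q → Set
  IsISet A T =
    ∀ x → (x ∈ T) ⇔
      (∃[ a₁ ] ∃[ a₂ ] ∃[ a₃ ] ∃[ a₄ ] ∃[ a₅ ] ∃[ a₆ ]
        (a₁ ∈ A × a₂ ∈ A × a₃ ∈ A × a₄ ∈ A × a₅ ∈ A × a₆ ∈ A ×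
         x ≡ a₁ *F (a₂ -F a₃) +F a₄ *F (a₅ -F a₆)))

{-# OPTIONS --safe #-}

-- Call ξ a ratio if ξ (c − d) = a − b with a, b, c, d ∈ A and c ≠ d; then a collision
-- x + ξ y = x′ + ξ y′ is the same as one of the map (x , y) ↦ x (c − d) + y (a − b) from A × A to I(A).
-- By Cauchy–Schwarz a map into a set of size t has at least (size of the domain)² / t collisions.
--
-- If every ξ is a ratio, summing over ξ gives few collisions: those with (x , y) ≠ (x′ , y′)
-- determine ξ, so there are at most q |A|² + |A|⁴ ≤ 2 q |A|² in all, whence |A|² ≤ 2 |I(A)|.
--
-- Otherwise, unless |A| = 1, some ratio ξ has ξ + 1 not a ratio, so that (ξ + 1) y − z determines
-- y, z ∈ A. For a collision and z ∈ A this value is ξ y′ + (y − x) + (x′ − z), so the collision and z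
-- are determined by y′ ∈ A and two elements of A − A. Thus there are at most |A − A|² collisions
-- and |A|⁴ ≤ |I(A)| |A − A|²; together with |A| ≤ |I(A)| this is the claim.
module Submission where

-- Counting with lists: injections, collisions and Cauchy-Schwarz.

module Counting where

  open import Data.Nat.Base
  open import Data.Nat.Properties
  open import Data.Nat.Tactic.RingSolver using (solve-∀)
  open import Data.List.Base using (List; []; _∷_; _++_; length; map; filter; cartesianProduct)
  open import Data.List.Properties using (length-map; length-++)
  open import Data.List.Membership.Propositional using (_∈_)
  open import Data.List.Membership.Propositional.Properties
  open import Data.List.Relation.Unary.All using (lookup)
  open import Data.List.Relation.Unary.Any using (here; there)
  open import Data.List.Relation.Unary.AllPairs using ([]; _∷_)
  open import Data.List.Relation.Unary.Unique.Propositional using (Unique)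
  import Data.List.Relation.Unary.Unique.Propositional.Properties as Unique
  open import Data.Product.Base using (_×_; _,_; proj₁; proj₂)
  open import Data.Sum.Base using (inj₁; inj₂)
  open import Relation.Nullary using (yes; no; ¬_; ¬?; contradiction)
  open import Relation.Binary.Definitions using (DecidableEquality)
  open import Relation.Binary.PropositionalEquality

  m*m≤n*n⇒m≤n : ∀ {m n} → m * m ≤ n * n → m ≤ n
  m*m≤n*n⇒m≤n m²≤n² = ≮⇒≥ λ n<m → <⇒≱ (*-mono-< n<m n<m) m²≤n²

  -- The slack is the square of the difference `k` of the two numbers; ordering them first makes `k`
  -- natural.
  4mn≤[m+n]² : ∀ m n → 4 * (m * n) ≤ (m + n) * (m + n)
  4mn≤[m+n]² m n with ≤-total m n
  ... | inj₁ m≤n with k , refl ← m≤n⇒∃[o]m+o≡n m≤n =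
    ≤-trans (m≤m+n _ (k * k)) (≤-reflexive (square m k))
    where
    square : ∀ m k → 4 * (m * (m + k)) + k * k ≡ (m + (m + k)) * (m + (m + k))
    square = solve-∀
  ... | inj₂ n≤m with k , refl ← m≤n⇒∃[o]m+o≡n n≤m =
    ≤-trans (m≤m+n _ (k * k)) (≤-reflexive (square n k))
    where
    square : ∀ n k → 4 * ((n + k) * n) + k * k ≡ (n + k + n) * (n + k + n)
    square = solve-∀

  -- Here `u` is the size of one fibre, `v` that of the rest, `m` the number of remaining values and
  -- `e` the number of collisions among the rest. Besides v² ≤ m e one needs 2 u v ≤ m u² + e, which
  -- holds because (2 u v)² ≤ 4 (m u²) e ≤ (m u² + e)².
  cauchy-schwarz-step : ∀ n u v m e → n ≤ u + v → v * v ≤ m * e →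
                        n * n ≤ suc m * (u * u + e)
  cauchy-schwarz-step n u v m e n≤u+v v²≤me = begin
    n * n                              ≤⟨ *-mono-≤ n≤u+v n≤u+v ⟩
    (u + v) * (u + v)                  ≡⟨ expandˡ u v ⟩
    u * u + v * v + 2 * (u * v)        ≤⟨ +-mono-≤ (+-monoʳ-≤ (u * u) v²≤me) (m*m≤n*n⇒m≤n am-gm) ⟩
    u * u + m * e + (m * (u * u) + e)  ≡⟨ expandʳ u m e ⟩
    suc m * (u * u + e)                ∎
    where
    open ≤-Reasoning
    expandˡ : ∀ u v → (u + v) * (u + v) ≡ u * u + v * v + 2 * (u * v)
    expandˡ = solve-∀
    expandʳ : ∀ u m e → u * u + m * e + (m * (u * u) + e) ≡ suc m * (u * u + e)
    expandʳ = solve-∀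
    assoc₁ : ∀ u v → 2 * (u * v) * (2 * (u * v)) ≡ 4 * (u * u * (v * v))
    assoc₁ = solve-∀
    assoc₂ : ∀ u m e → 4 * (u * u * (m * e)) ≡ 4 * (m * (u * u) * e)
    assoc₂ = solve-∀
    am-gm : 2 * (u * v) * (2 * (u * v)) ≤ (m * (u * u) + e) * (m * (u * u) + e)
    am-gm = begin
      2 * (u * v) * (2 * (u * v))               ≡⟨ assoc₁ u v ⟩
      4 * (u * u * (v * v))                     ≤⟨ *-monoʳ-≤ 4 (*-monoʳ-≤ (u * u) v²≤me) ⟩
      4 * (u * u * (m * e))                     ≡⟨ assoc₂ u m e ⟩
      4 * (m * (u * u) * e)                     ≤⟨ 4mn≤[m+n]² (m * (u * u)) e ⟩
      (m * (u * u) + e) * (m * (u * u) + e)     ∎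

  length-cartesianProduct : ∀ {A B : Set} (xs : List A) (ys : List B) →
    length (cartesianProduct xs ys) ≡ length xs * length ys
  length-cartesianProduct []       ys = refl
  length-cartesianProduct (x ∷ xs) ys = trans
    (length-++ (map (x ,_) ys))
    (cong₂ _+_ (length-map (x ,_) ys) (length-cartesianProduct xs ys))

  -- Induction on `xs`: one occurrence of `f x` is cut out of `zs`, and by injectivity the images of
  -- the other entries survive in `ys ++ zs`.
  length-injection : ∀ {A B : Set} {xs : List A} {zs : List B} (f : A → B) → Unique xs →
    (∀ {x} → x ∈ xs → f x ∈ zs) →
    (∀ {x y} → x ∈ xs → y ∈ xs → f x ≡ f y → x ≡ y) →
    length xs ≤ length zs
  length-injection {xs = []}     f _           f∈ f-inj = z≤n
  length-injection {xs = x ∷ xs} f (x∉ ∷ uniq) f∈ f-inj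
    with ys , zs , refl ← ∈-∃++ (f∈ (here refl)) = begin
    suc (length xs)            ≤⟨ s≤s (length-injection f uniq f∈′ (λ p q → f-inj (there p) (there q))) ⟩
    suc (length (ys ++ zs))    ≡⟨ cong suc (length-++ ys) ⟩
    suc (length ys + length zs) ≡⟨ +-suc (length ys) (length zs) ⟨
    length ys + suc (length zs) ≡⟨ length-++ ys ⟨
    length (ys ++ f x ∷ zs)    ∎
    where
    open ≤-Reasoning
    f∈′ : ∀ {y} → y ∈ xs → f y ∈ ys ++ zs
    f∈′ y∈ with ∈-++⁻ ys (f∈ (there y∈))
    ... | inj₁ fy∈ys           = ∈-++⁺ˡ fy∈ys
    ... | inj₂ (there fy∈zs)   = ∈-++⁺ʳ ys fy∈zs
    ... | inj₂ (here fy≡fx)    =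
      contradiction (f-inj (here refl) (there y∈) (sym fy≡fx)) (lookup x∉ y∈)

  module Collisions {A B : Set} (_≟_ : DecidableEquality B) (f : A → B) where

    collisions : List A → List (A × A)
    collisions xs = filter (λ (x , y) → f x ≟ f y) (cartesianProduct xs xs)

    collisions⁺ : ∀ {xs} → Unique xs → Unique (collisions xs)
    collisions⁺ uniq = Unique.filter⁺ _ (Unique.cartesianProduct⁺ uniq uniq)

    ∈-collisions⁺ : ∀ {xs x y} → x ∈ xs → y ∈ xs → f x ≡ f y → (x , y) ∈ collisions xs
    ∈-collisions⁺ x∈ y∈ eq = ∈-filter⁺ (λ (x , y) → f x ≟ f y) (∈-cartesianProduct⁺ x∈ y∈) eq

    ∈-collisions⁻ : ∀ xs {x y} → (x , y) ∈ collisions xs → x ∈ xs × y ∈ xs × f x ≡ f y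
    ∈-collisions⁻ xs p with p′ , eq ← ∈-filter⁻ (λ (x , y) → f x ≟ f y) p
      with x∈ , y∈ ← ∈-cartesianProduct⁻ xs xs p′ = x∈ , y∈ , eq

    -- Cauchy–Schwarz for the fibre sizes of f.
    collisions-lower-bound : ∀ {xs} (zs : List B) → Unique xs → (∀ {x} → x ∈ xs → f x ∈ zs) →
      length xs * length xs ≤ length zs * length (collisions xs)
    collisions-lower-bound {[]}    []       uniq f∈ = z≤n
    collisions-lower-bound {_ ∷ _} []       uniq f∈ with () ← f∈ (here refl)
    collisions-lower-bound {xs}    (z ∷ zs) uniq f∈ = begin
      length xs * length xs
        ≤⟨ cauchy-schwarz-step (length xs) (length ins) (length outs) (length zs) _ split
             (collisions-lower-bound zs uniq-out f∈′) ⟩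
      suc (length zs) * (length ins * length ins + length (collisions outs))
        ≤⟨ *-monoʳ-≤ (suc (length zs)) recombine ⟩
      suc (length zs) * length (collisions xs) ∎
      where
      open ≤-Reasoning
      in?  = λ x → f x ≟ z
      out? = λ x → ¬? (f x ≟ z)
      -- The fibre over `z` is split off; `f` sends the remainder into `zs`, so induction applies to
      -- it.
      ins  = filter in? xs
      outs = filter out? xs
      uniq-in  = Unique.filter⁺ in? uniq
      uniq-out = Unique.filter⁺ out? uniq

      f∈′ : ∀ {x} → x ∈ outs → f x ∈ zs
      f∈′ x∈ with x∈xs , fx≢z ← ∈-filter⁻ out? x∈ with f∈ x∈xs
      ... | here fx≡z  = contradiction fx≡z fx≢z
      ... | there fx∈  = fx∈

      split : length xs ≤ length ins + length outs
      split = ≤-trans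
        (length-injection (λ x → x) uniq cover (λ _ _ eq → eq))
        (≤-reflexive (length-++ ins))
        where
        cover : ∀ {x} → x ∈ xs → x ∈ ins ++ outs
        cover {x} x∈ with f x ≟ z
        ... | yes fx≡z = ∈-++⁺ˡ (∈-filter⁺ in? x∈ fx≡z)
        ... | no  fx≢z = ∈-++⁺ʳ ins (∈-filter⁺ out? x∈ fx≢z)

      -- Any two entries of the fibre over `z` collide, and these pairs are disjoint from the
      -- collisions within `outs`, so both kinds add up.
      recombine : length ins * length ins + length (collisions outs) ≤ length (collisions xs)
      recombine = begin
        length ins * length ins + length (collisions outs)
          ≡⟨ cong (_+ length (collisions outs)) (length-cartesianProduct ins ins) ⟨
        length (cartesianProduct ins ins) + length (collisions outs)
          ≡⟨ length-++ (cartesianProduct ins ins) ⟨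
        length (cartesianProduct ins ins ++ collisions outs)
          ≤⟨ length-injection (λ p → p)
               (Unique.++⁺ (Unique.cartesianProduct⁺ uniq-in uniq-in) (collisions⁺ uniq-out) disjoint)
               embed (λ _ _ eq → eq) ⟩
        length (collisions xs) ∎
        where
        disjoint : ∀ {p} → ¬ (p ∈ cartesianProduct ins ins × p ∈ collisions outs)
        disjoint {x , y} (p , q) with x∈ , _ ← ∈-cartesianProduct⁻ ins ins p
          with x∈′ , _ ← ∈-collisions⁻ outs q =
          proj₂ (∈-filter⁻ out? {xs = xs} x∈′) (proj₂ (∈-filter⁻ in? {xs = xs} x∈))
        embed : ∀ {p} → p ∈ cartesianProduct ins ins ++ collisions outs → p ∈ collisions xs
        embed {x , y} p with ∈-++⁻ (cartesianProduct ins ins) p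
        ... | inj₁ q with x∈ , y∈ ← ∈-cartesianProduct⁻ ins ins q
          with x∈xs , fx≡z ← ∈-filter⁻ in? {xs = xs} x∈ | y∈xs , fy≡z ← ∈-filter⁻ in? {xs = xs} y∈ =
          ∈-collisions⁺ x∈xs y∈xs (trans fx≡z (sym fy≡z))
        ... | inj₂ q with x∈ , y∈ , eq ← ∈-collisions⁻ outs q =
          ∈-collisions⁺ (proj₁ (∈-filter⁻ out? {xs = xs} x∈)) (proj₁ (∈-filter⁻ out? {xs = xs} y∈)) eq

-- Residues modulo q as integers up to congruence.

module ModularArithmetic where

  open import Defs
  open import Data.Nat.Base as ℕ using (ℕ; NonZero; zero; suc)
  open import Data.Nat.DivMod using (_mod_; _%_; _/_; m≡m%n+[m/n]*n; m%n<n)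
  open import Data.Nat.Divisibility using (∣⇒≤) renaming (_∣_ to _ℕ∣_)
  open import Data.Nat.Properties using (≤-<-trans; ⊔-pres-<m; <⇒≤; ≤⇒≯)
  open import Data.Nat.Primality using (Prime; euclidsLemma)
  open import Data.Integer.Base using (ℤ; +_; -_; _+_; _-_; _*_; ∣_∣; 0ℤ; 1ℤ)
  open import Data.Integer.Properties using (abs-*; pos-+; pos-*; m-n≡m⊖n; ⊖-≥;
    ∣m⊝n∣≤m⊔n; i≡j⇒i-j≡0; i-j≡0⇒i≡j; ∣i∣≡0⇒i≡0; +-injective)
  open import Data.Integer.Divisibility.Signed using (_∣_; divides; ∣⇒∣ᵤ; ∣ᵤ⇒∣; ∣m∣n⇒∣m+n; ∣n⇒∣m*n; ∣m⇒∣-m)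
  open import Data.Integer.Tactic.RingSolver using (solve-∀)
  open import Data.Fin.Base using (Fin; toℕ)
  open import Data.Fin.Properties using (toℕ-injective; toℕ-fromℕ<; toℕ<n)
  open import Data.Sum.Base using (_⊎_; map)
  open import Relation.Nullary using (contradiction)
  open import Relation.Binary.PropositionalEquality

  module Residues {q : ℕ} .{{_ : NonZero q}} where

    infix 4 q∣_ _≈_

    q∣_ : ℤ → Set
    q∣ x = (+ q) ∣ x

    -- As a record, the type keeps its two sides visible; the bare divisibility statement would show
    -- only their difference.
    record _≈_ (x y : ℤ) : Set where
      constructor congruent
      field divisible : q∣ (x - y)

    open _≈_ public

    -- Opaque, since otherwise ℤ arithmetic on residues unfolds into case distinctions on signs.
    opaque
      ⟦_⟧ : Fin q → ℤ
      ⟦ x ⟧ = + toℕ x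

      ⟦⟧≡+toℕ : ∀ x → ⟦ x ⟧ ≡ + toℕ x
      ⟦⟧≡+toℕ x = refl

    ≈-reflexive : ∀ {x y} → x ≡ y → x ≈ y
    ≈-reflexive {x} refl = congruent (divides 0ℤ (i≡j⇒i-j≡0 {x} refl))

    ≈-sym : ∀ {x y} → x ≈ y → y ≈ x
    ≈-sym {x} {y} (congruent p) = congruent (subst q∣_ (identity x y) (∣m⇒∣-m p))
      where
      identity : ∀ x y → - (x - y) ≡ y - x
      identity = solve-∀

    ≈-trans : ∀ {x y z} → x ≈ y → y ≈ z → x ≈ z
    ≈-trans {x} {y} {z} (congruent p) (congruent r) =
      congruent (subst q∣_ (identity x y z) (∣m∣n⇒∣m+n p r))
      where
      identity : ∀ x y z → (x - y) + (y - z) ≡ x - z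
      identity = solve-∀

    +-cong : ∀ {x y u v} → x ≈ y → u ≈ v → x + u ≈ y + v
    +-cong {x} {y} {u} {v} (congruent p) (congruent r) =
      congruent (subst q∣_ (identity x y u v) (∣m∣n⇒∣m+n p r))
      where
      identity : ∀ x y u v → (x - y) + (u - v) ≡ (x + u) - (y + v)
      identity = solve-∀

    *-cong : ∀ {x y u v} → x ≈ y → u ≈ v → x * u ≈ y * v
    *-cong {x} {y} {u} {v} (congruent p) (congruent r) =
      congruent (subst q∣_ (identity x y u v) (∣m∣n⇒∣m+n (∣n⇒∣m*n u p) (∣n⇒∣m*n y r)))
      where
      identity : ∀ x y u v → u * (x - y) + y * (u - v) ≡ x * u - y * v
      identity = solve-∀

    opaque
      unfolding ⟦_⟧

      ⟦mod⟧ : ∀ m → + toℕ (m mod q) ≈ + m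
      -- By division with remainder the residue is `m` minus (m / q) q, hence the negative quotient
      -- as witness.
      ⟦mod⟧ m = congruent (divides (- + (m / q)) (begin
        + toℕ (m mod q) - + m
          ≡⟨ cong (λ k → + k - + m) (toℕ-fromℕ< (m%n<n m q)) ⟩
        + (m % q) - + m
          ≡⟨ cong (λ k → + (m % q) - + k) (m≡m%n+[m/n]*n m q) ⟩
        + (m % q) - + (m % q ℕ.+ m / q ℕ.* q)
          ≡⟨ cong (λ k → + (m % q) - k) (pos-+ (m % q) _) ⟩
        + (m % q) - (+ (m % q) + + (m / q ℕ.* q))
          ≡⟨ cong (λ k → + (m % q) - (+ (m % q) + k)) (pos-* (m / q) q) ⟩
        + (m % q) - (+ (m % q) + + (m / q) * + q)
          ≡⟨ identity (+ (m % q)) (+ (m / q)) (+ q) ⟩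
        - + (m / q) * + q ∎))
        where
        open ≡-Reasoning
        identity : ∀ r s t → r - (r + s * t) ≡ - s * t
        identity = solve-∀

      ⟦+⟧ : ∀ x y → ⟦ x +F y ⟧ ≈ ⟦ x ⟧ + ⟦ y ⟧
      ⟦+⟧ x y = subst (⟦ x +F y ⟧ ≈_) (pos-+ (toℕ x) (toℕ y)) (⟦mod⟧ _)

      ⟦*⟧ : ∀ x y → ⟦ x *F y ⟧ ≈ ⟦ x ⟧ * ⟦ y ⟧
      ⟦*⟧ x y = subst (⟦ x *F y ⟧ ≈_) (pos-* (toℕ x) (toℕ y)) (⟦mod⟧ _)

      -- Since `toℕ y` is below `q`, the truncated subtraction is exact. Before reduction the value
      -- thus exceeds the integer difference by exactly `q`, which gives the quotient 1.
      ⟦-⟧ : ∀ x y → ⟦ x -F y ⟧ ≈ ⟦ x ⟧ - ⟦ y ⟧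
      ⟦-⟧ x y = ≈-trans (⟦mod⟧ _) (congruent (divides 1ℤ (begin
        + (toℕ x ℕ.+ (q ℕ.∸ toℕ y)) - (⟦ x ⟧ - ⟦ y ⟧)  ≡⟨ cong (λ k → k - (⟦ x ⟧ - ⟦ y ⟧)) (pos-+ (toℕ x) _) ⟩
        (⟦ x ⟧ + + (q ℕ.∸ toℕ y)) - (⟦ x ⟧ - ⟦ y ⟧)
          ≡⟨ cong (λ k → (⟦ x ⟧ + k) - (⟦ x ⟧ - ⟦ y ⟧)) (trans (m-n≡m⊖n q (toℕ y)) (⊖-≥ (<⇒≤ (toℕ<n y)))) ⟨
        (⟦ x ⟧ + (+ q - ⟦ y ⟧)) - (⟦ x ⟧ - ⟦ y ⟧)       ≡⟨ identity ⟦ x ⟧ ⟦ y ⟧ (+ q) ⟩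
        1ℤ * + q                                        ∎)))
        where
        open ≡-Reasoning
        identity : ∀ r s t → (r + (t - s)) - (r - s) ≡ 1ℤ * t
        identity = solve-∀

      -- Two residues differ by less than `q` in absolute value, and the only such multiple of `q`
      -- is 0.
      q∣-injective : ∀ {x y} → q∣ (⟦ x ⟧ - ⟦ y ⟧) → x ≡ y
      q∣-injective {x} {y} p = toℕ-injective (+-injective (i-j≡0⇒i≡j ⟦ x ⟧ ⟦ y ⟧ (∣i∣≡0⇒i≡0 difference≡0)))
        where
        difference<q : ∣ ⟦ x ⟧ - ⟦ y ⟧ ∣ ℕ.< q
        difference<q = subst (λ k → ∣ k ∣ ℕ.< q) (sym (m-n≡m⊖n (toℕ x) (toℕ y)))
          (≤-<-trans (∣m⊝n∣≤m⊔n (toℕ x) (toℕ y)) (⊔-pres-<m (toℕ<n x) (toℕ<n y)))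
        difference≡0 : ∣ ⟦ x ⟧ - ⟦ y ⟧ ∣ ≡ 0
        difference≡0 with ∣ ⟦ x ⟧ - ⟦ y ⟧ ∣ in eq
        ... | zero  = refl
        ... | suc k = contradiction (subst (ℕ._< q) eq difference<q)
          (≤⇒≯ (∣⇒≤ (subst (q ℕ∣_) eq (∣⇒∣ᵤ p))))

    -- This is where primality enters; it stands in for division in the field.
    q∣-product : Prime q → ∀ x y → q∣ (x * y) → q∣ x ⊎ q∣ y
    q∣-product q-prime x y q∣xy = map ∣ᵤ⇒∣ ∣ᵤ⇒∣
      (euclidsLemma ∣ x ∣ ∣ y ∣ q-prime (subst (q ℕ∣_) (abs-* x y) (∣⇒∣ᵤ q∣xy)))

-- Subsets as lists, then ratios and the two cases of the proof.

module DifferencesAndI where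

  open import Defs
  open import Data.Nat.Base as ℕ using (ℕ; zero; suc; NonZero)
  import Data.Nat.Properties as ℕ
  import Data.Nat.Tactic.RingSolver as ℕ-Solver
  open import Data.Nat.Primality using (Prime)
  open import Data.Integer.Base using (ℤ; +_; -_; _+_; _-_; _*_; 0ℤ; 1ℤ)
  open import Data.Integer.Divisibility.Signed using (∣m∣n⇒∣m+n; ∣n⇒∣m*n; ∣m⇒∣-m; _∣?_; divides)
  open import Data.Integer.Tactic.RingSolver using (solve-∀)
  open import Data.Fin.Base using (Fin; zero; suc; toℕ)
  open import Data.Fin.Properties using (_≟_; any?; all?; ¬∀⟶∃¬; suc-injective)
  open import Data.Fin.Subset using (Subset; inside; outside; ∣_∣; Nonempty) renaming (_∈_ to _∈ₛ_)
  open import Data.Fin.Subset.Properties using (_∈?_)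
  open import Data.Vec.Base using ([]; _∷_; here; there)
  open import Data.List.Base as List using (List; []; _∷_; [_]; _++_; length; cartesianProduct; allFin)
  open import Data.List.Properties using (length-map; length-++; length-tabulate)
  open import Data.List.Membership.Propositional using (_∈_)
  open import Data.List.Membership.Propositional.Properties
  open import Data.List.Relation.Unary.Any using (here; there)
  import Data.List.Relation.Unary.All as All
  import Data.List.Relation.Unary.All.Properties as All
  open import Data.List.Relation.Unary.AllPairs using ([]; _∷_)
  open import Data.List.Relation.Unary.Unique.Propositional using (Unique)
  import Data.List.Relation.Unary.Unique.Propositional.Properties as Unique
  open import Data.Product.Base using (∃-syntax; _×_; _,_; proj₁; proj₂)
  open import Data.Product.Properties using (≡-dec; ,-injectiveˡ; ,-injectiveʳ)
  open import Data.Sum.Base as Sum using (_⊎_; inj₁; inj₂; [_,_]′)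
  open import Function.Base using (id; it)
  open import Function.Bundles using (module Equivalence)
  open import Relation.Nullary using (Dec; yes; no; ¬_; ¬?; contradiction)
  open import Relation.Nullary.Decidable using (_×-dec_; map′; decidable-stable)
  open import Relation.Binary.PropositionalEquality hiding ([_])
  open Counting
  open ModularArithmetic

  elements : ∀ {n} → Subset n → List (Fin n)
  elements []            = []
  elements (inside ∷ p)  = zero ∷ List.map suc (elements p)
  elements (outside ∷ p) = List.map suc (elements p)

  length-elements : ∀ {n} (p : Subset n) → length (elements p) ≡ ∣ p ∣
  length-elements []            = refl
  length-elements (inside ∷ p)  = cong suc (trans (length-map suc (elements p)) (length-elements p))
  length-elements (outside ∷ p) = trans (length-map suc (elements p)) (length-elements p)

  elements-unique : ∀ {n} (p : Subset n) → Unique (elements p)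
  elements-unique []            = []
  elements-unique (inside ∷ p)  =
    All.map⁺ (All.universal (λ _ ()) (elements p)) ∷ Unique.map⁺ suc-injective (elements-unique p)
  elements-unique (outside ∷ p) = Unique.map⁺ suc-injective (elements-unique p)

  ∈-elements⁺ : ∀ {n} {p : Subset n} {x} → x ∈ₛ p → x ∈ elements p
  ∈-elements⁺ here                         = here refl
  ∈-elements⁺ {p = inside ∷ p}  (there x∈) = there (∈-map⁺ suc (∈-elements⁺ x∈))
  ∈-elements⁺ {p = outside ∷ p} (there x∈) = ∈-map⁺ suc (∈-elements⁺ x∈)

  ∈-elements⁻ : ∀ {n} {p : Subset n} {x} → x ∈ elements p → x ∈ₛ p
  ∈-elements⁻ {p = inside ∷ p}  (here refl) = here
  ∈-elements⁻ {p = inside ∷ p}  (there x∈)  with _ , y∈ , refl ← ∈-map⁻ suc x∈ = there (∈-elements⁻ y∈)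
  ∈-elements⁻ {p = outside ∷ p} x∈          with _ , y∈ , refl ← ∈-map⁻ suc x∈ = there (∈-elements⁻ y∈)

  -- Search downwards from `m`: `P` always fails at the current index, and `P 0` guarantees that the
  -- search succeeds. It finds a ratio whose successor is not one.
  last-true : ∀ {P : ℕ → Set} → (∀ n → Dec (P n)) → P 0 → ∀ m → ¬ P m → ∃[ n ] (P n × ¬ P (suc n))
  last-true P? p₀ zero    ¬pₘ = contradiction p₀ ¬pₘ
  last-true P? p₀ (suc m) ¬pₘ with P? m
  ... | yes pₘ₋₁ = m , pₘ₋₁ , ¬pₘ
  ... | no ¬pₘ₋₁ = last-true P? p₀ m ¬pₘ₋₁

  -- Slopes, ratios and collisions of the bilinear form.

  module Slopes {q : ℕ} .{{_ : NonZero q}} (q-prime : Prime q) (A : Subset q) where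

    open Residues {q}

    -- A record rather than a synonym, so that with-abstraction never normalises the products in ℤ.
    record Slope (n : ℤ) (a b c d : Fin q) : Set where
      constructor slope
      field divisible : q∣ ((⟦ a ⟧ - ⟦ b ⟧) - n * (⟦ c ⟧ - ⟦ d ⟧))

    slope? : ∀ n a b c d → Dec (Slope n a b c d)
    slope? n a b c d = map′ slope Slope.divisible ((+ q) ∣? _)

    -- Indexing by integers lets the walk 0, 1, 2, ... proceed without reduction modulo `q`.
    Ratio : ℤ → Set
    Ratio n = ∃[ a ] ∃[ b ] ∃[ c ] ∃[ d ]
      (a ∈ₛ A × b ∈ₛ A × c ∈ₛ A × d ∈ₛ A × c ≢ d × Slope n a b c d)

    ratio? : ∀ n → Dec (Ratio n)
    ratio? n = any? λ a → any? λ b → any? λ c → any? λ d →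
      (a ∈? A) ×-dec (b ∈? A) ×-dec (c ∈? A) ×-dec (d ∈? A) ×-dec ¬? (c ≟ d) ×-dec slope? n a b c d

    slope-0 : ∀ a c d → Slope 0ℤ a a c d
    slope-0 a c d = slope (divides 0ℤ (identity ⟦ a ⟧ (⟦ c ⟧ - ⟦ d ⟧)))
      where
      identity : ∀ a δ → (a - a) - 0ℤ * δ ≡ 0ℤ
      identity = solve-∀

    slope-horizontal : ∀ n a b c → Slope n a b c c → a ≡ b
    slope-horizontal n a b c (slope p) = q∣-injective (subst q∣_ (identity n ⟦ a ⟧ ⟦ b ⟧ ⟦ c ⟧) p)
      where
      identity : ∀ n a b c → (a - b) - n * (c - c) ≡ a - b
      identity = solve-∀

    -- Subtracting the two relations shows that `q` divides (ξ - ζ) (c - d), and `q` is prime.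
    slope-unique : ∀ ξ ζ a b c d → Slope ⟦ ξ ⟧ a b c d → Slope ⟦ ζ ⟧ a b c d → ξ ≡ ζ ⊎ c ≡ d
    slope-unique ξ ζ a b c d (slope p) (slope r) = Sum.map q∣-injective q∣-injective
      (q∣-product q-prime (⟦ ξ ⟧ - ⟦ ζ ⟧) (⟦ c ⟧ - ⟦ d ⟧)
        (subst q∣_ (identity ⟦ ξ ⟧ ⟦ ζ ⟧ (⟦ a ⟧ - ⟦ b ⟧) (⟦ c ⟧ - ⟦ d ⟧)) (∣m∣n⇒∣m+n r (∣m⇒∣-m p))))
      where
      identity : ∀ ξ ζ α γ → (α - ζ * γ) + - (α - ξ * γ) ≡ (ξ - ζ) * γ
      identity = solve-∀

    -- For ξ = (a - b) / (c - d) this is x + ξ y multiplied by c - d, which places it in I(A).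
    -- Opacity keeps the modular arithmetic from unfolding.
    opaque
      form : (a b c d x y : Fin q) → Fin q
      form a b c d x y = x *F (c -F d) +F y *F (a -F b)

      form≡ : ∀ a b c d x y → form a b c d x y ≡ x *F (c -F d) +F y *F (a -F b)
      form≡ a b c d x y = refl

    ⟦form⟧ : ∀ a b c d x y →
      ⟦ form a b c d x y ⟧ ≈ ⟦ x ⟧ * (⟦ c ⟧ - ⟦ d ⟧) + ⟦ y ⟧ * (⟦ a ⟧ - ⟦ b ⟧)
    ⟦form⟧ a b c d x y = ≈-trans (≈-reflexive (cong ⟦_⟧ (form≡ a b c d x y))) (≈-trans (⟦+⟧ _ _) (+-cong
      (≈-trans (⟦*⟧ x _) (*-cong {⟦ x ⟧} {⟦ x ⟧} {⟦ c -F d ⟧} {⟦ c ⟧ - ⟦ d ⟧} (≈-reflexive refl) (⟦-⟧ c d)))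
      (≈-trans (⟦*⟧ y _) (*-cong {⟦ y ⟧} {⟦ y ⟧} {⟦ a -F b ⟧} {⟦ a ⟧ - ⟦ b ⟧} (≈-reflexive refl) (⟦-⟧ a b)))))

    difference-cong : ∀ x y z w → x -F y ≡ z -F w → ⟦ x ⟧ - ⟦ y ⟧ ≈ ⟦ z ⟧ - ⟦ w ⟧
    difference-cong x y z w eq =
      ≈-trans (≈-sym (⟦-⟧ x y)) (≈-trans (≈-reflexive (cong ⟦_⟧ eq)) (⟦-⟧ z w))

    -F-cancelˡ : ∀ z x y → z -F x ≡ z -F y → x ≡ y
    -F-cancelˡ z x y eq = q∣-injective (subst q∣_ (identity ⟦ x ⟧ ⟦ y ⟧ ⟦ z ⟧)
      (∣m⇒∣-m (difference-cong z x z y eq .divisible)))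
      where
      identity : ∀ x y z → - ((z - x) - (z - y)) ≡ x - y
      identity = solve-∀

    -F-cancelʳ : ∀ z x y → x -F z ≡ y -F z → x ≡ y
    -F-cancelʳ z x y eq = q∣-injective (subst q∣_ (identity ⟦ x ⟧ ⟦ y ⟧ ⟦ z ⟧)
      (difference-cong x z y z eq .divisible))
      where
      identity : ∀ x y z → (x - z) - (y - z) ≡ x - y
      identity = solve-∀

    -- Replacing a - b by n (c - d) turns the equality of forms into a multiple of c - d. As c ≠ d,
    -- this factor cancels modulo `q`.
    form-collision : ∀ n a b c d x y x′ y′ → c ≢ d → Slope n a b c d →
      form a b c d x y ≡ form a b c d x′ y′ → Slope n x′ x y y′
    form-collision n a b c d x y x′ y′ c≢d (slope ratio) eq = slope
      ([ (λ q∣c-d → contradiction (q∣-injective q∣c-d) c≢d) , id ]′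
        (q∣-product q-prime (⟦ c ⟧ - ⟦ d ⟧) _ (subst q∣_
          (identity (⟦ c ⟧ - ⟦ d ⟧) (⟦ a ⟧ - ⟦ b ⟧) ⟦ x ⟧ ⟦ y ⟧ ⟦ x′ ⟧ ⟦ y′ ⟧ n)
          (∣m∣n⇒∣m+n (forms-agree .divisible) (∣n⇒∣m*n (⟦ y ⟧ - ⟦ y′ ⟧) ratio)))))
      where
      forms-agree : ⟦ x′ ⟧ * (⟦ c ⟧ - ⟦ d ⟧) + ⟦ y′ ⟧ * (⟦ a ⟧ - ⟦ b ⟧)
                  ≈ ⟦ x ⟧ * (⟦ c ⟧ - ⟦ d ⟧) + ⟦ y ⟧ * (⟦ a ⟧ - ⟦ b ⟧)
      forms-agree = ≈-trans (≈-sym (⟦form⟧ a b c d x′ y′))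
        (≈-trans (≈-reflexive (cong ⟦_⟧ (sym eq))) (⟦form⟧ a b c d x y))
      identity : ∀ α β x y x′ y′ n →
        ((x′ * α + y′ * β) - (x * α + y * β)) + (y - y′) * (β - n * α)
          ≡ α * ((x′ - x) - n * (y - y′))
      identity = solve-∀

    -- Both slopes say that n y′ + (y − x) + (x′ − z) ≡ (n + 1) y − z.
    slope-successor : ∀ n x y x′ y′ z x₁ y₁ x₁′ z₁ → Slope n x′ x y y′ → Slope n x₁′ x₁ y₁ y′ →
      y -F x ≡ y₁ -F x₁ → x′ -F z ≡ x₁′ -F z₁ → Slope (1ℤ + n) z z₁ y y₁
    slope-successor n x y x′ y′ z x₁ y₁ x₁′ z₁ (slope p) (slope p₁) d-eq d′-eq = slope (subst q∣_
      (identity n ⟦ x ⟧ ⟦ y ⟧ ⟦ x′ ⟧ ⟦ y′ ⟧ ⟦ z ⟧ ⟦ x₁ ⟧ ⟦ y₁ ⟧ ⟦ x₁′ ⟧ ⟦ z₁ ⟧)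
      (∣m∣n⇒∣m+n
        (∣m∣n⇒∣m+n p (∣m⇒∣-m p₁))
        (∣m⇒∣-m (∣m∣n⇒∣m+n (difference-cong y x y₁ x₁ d-eq .divisible)
                           (difference-cong x′ z x₁′ z₁ d′-eq .divisible)))))
      where
      identity : ∀ n x y x′ y′ z x₁ y₁ x₁′ z₁ →
        (((x′ - x) - n * (y - y′)) + - ((x₁′ - x₁) - n * (y₁ - y′))) +
        - (((y - x) - (y₁ - x₁)) + ((x′ - z) - (x₁′ - z₁)))
          ≡ (z - z₁) - (1ℤ + n) * (y - y₁)
      identity = solve-∀

    -- The lists of A, A - A and I(A), and trivial size bounds.

    module Sets (S T : Subset q) (nonempty : Nonempty A) (isD : IsDiffSet A S) (isI : IsISet A T) where

      as ss ts : List (Fin q)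
      as = elements A
      ss = elements S
      ts = elements T

      pairs : List (Fin q × Fin q)
      pairs = cartesianProduct as as

      as-unique : Unique as
      as-unique = elements-unique A

      pairs-unique : Unique pairs
      pairs-unique = Unique.cartesianProduct⁺ as-unique as-unique

      a₀ : Fin q
      a₀ = proj₁ nonempty

      difference∈ : ∀ {x y} → x ∈ as → y ∈ as → x -F y ∈ ss
      difference∈ x∈ y∈ = ∈-elements⁺ (Equivalence.from (isD _)
        (_ , _ , ∈-elements⁻ x∈ , ∈-elements⁻ y∈ , refl))

      form∈ : ∀ {a b c d x y} → a ∈ₛ A → b ∈ₛ A → c ∈ₛ A → d ∈ₛ A → x ∈ as → y ∈ as →
              form a b c d x y ∈ ts
      form∈ a∈ b∈ c∈ d∈ x∈ y∈ = ∈-elements⁺ (Equivalence.from (isI _)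
        (_ , _ , _ , _ , _ , _ , ∈-elements⁻ x∈ , c∈ , d∈ , ∈-elements⁻ y∈ , a∈ , b∈ , form≡ _ _ _ _ _ _))

      a₀∈as : a₀ ∈ as
      a₀∈as = ∈-elements⁺ (proj₂ nonempty)

      |A|≤|S| : length as ℕ.≤ length ss
      |A|≤|S| = length-injection (λ x → x -F a₀) as-unique (λ x∈ → difference∈ x∈ a₀∈as)
        λ {x} {y} _ _ → -F-cancelʳ a₀ x y

      |T|-positive : 1 ℕ.≤ length ts
      |T|-positive = length-injection {xs = [ a₀ ]} (form a₀ a₀ a₀ a₀ a₀) (All.[] ∷ [])
        (λ { (here refl) → form∈ a₀∈ a₀∈ a₀∈ a₀∈ a₀∈as a₀∈as })
        λ { (here refl) (here refl) _ → refl }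
        where a₀∈ = proj₂ nonempty

      |A|-positive : 1 ℕ.≤ length as
      |A|-positive = length-injection {xs = [ a₀ ]} id (All.[] ∷ [])
        (λ { (here refl) → a₀∈as })
        λ { (here refl) (here refl) _ → refl }

      |S|-positive : 1 ℕ.≤ length ss
      |S|-positive = ℕ.≤-trans |A|-positive |A|≤|S|

      -- Distinct `x` and `y` in `A` would give the ratio (x - x) / (x - y) = 0.
      ¬ratio₀⇒|A|≤1 : ¬ Ratio 0ℤ → length as ℕ.≤ 1
      ¬ratio₀⇒|A|≤1 ¬ratio₀ = length-injection {zs = [ a₀ ]} (λ _ → a₀) as-unique (λ _ → here refl)
        λ {x} {y} x∈ y∈ _ → decidable-stable (x ≟ y) λ x≢y →
          ¬ratio₀ (x , x , x , y , ∈-elements⁻ x∈ , ∈-elements⁻ x∈ , ∈-elements⁻ x∈ , ∈-elements⁻ y∈ , x≢y ,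
                   slope-0 x x y)

      -- The case in which every residue is a ratio.

      module AllRatios (ratio : ∀ (ξ : Fin q) → Ratio ⟦ ξ ⟧) where

        -- Keeping ξ in the output joins the forms for all ξ into one map into a set of size q
        -- |I(A)|, so Cauchy-Schwarz is applied once instead of summing over ξ.
        f : Fin q × (Fin q × Fin q) → Fin q × Fin q
        f (ξ , x , y) with a , b , c , d , _ ← ratio ξ = ξ , form a b c d x y

        open Collisions (≡-dec _≟_ _≟_) f

        domain : List (Fin q × (Fin q × Fin q))
        domain = cartesianProduct (allFin q) pairs

        f∈ : ∀ {w} → w ∈ domain → f w ∈ cartesianProduct (allFin q) ts
        f∈ {ξ , x , y} w∈ with a , b , c , d , a∈ , b∈ , c∈ , d∈ , _ ← ratio ξ
          with _ , xy∈ ← ∈-cartesianProduct⁻ (allFin q) pairs w∈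
          with x∈ , y∈ ← ∈-cartesianProduct⁻ as as xy∈ =
          ∈-cartesianProduct⁺ (∈-allFin ξ) (form∈ a∈ b∈ c∈ d∈ x∈ y∈)

        length-allFin : length (allFin q) ≡ q
        length-allFin = length-tabulate {n = q} id

        length-domain : length domain ≡ q ℕ.* (length as ℕ.* length as)
        length-domain = trans (length-cartesianProduct (allFin q) pairs)
          (cong₂ ℕ._*_ length-allFin (length-cartesianProduct as as))

        domain-unique : Unique domain
        domain-unique = Unique.cartesianProduct⁺ (Unique.allFin⁺ q) pairs-unique

        collision : ∀ ξ x y ξ′ x′ y′ → f (ξ , x , y) ≡ f (ξ′ , x′ , y′) →
          ξ ≡ ξ′ × Slope ⟦ ξ ⟧ x′ x y y′
        collision ξ x y ξ′ x′ y′ eq with refl ← ,-injectiveˡ eq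
          with a , b , c , d , _ , _ , _ , _ , c≢d , r ← ratio ξ =
          refl , form-collision ⟦ ξ ⟧ a b c d x y x′ y′ c≢d r (,-injectiveʳ eq)

        -- The left summand receives trivial collisions, the right one nontrivial collisions; their
        -- sizes give the terms q |A|² and |A|⁴.
        Code : Set
        Code = (Fin q × (Fin q × Fin q)) ⊎ ((Fin q × Fin q) × (Fin q × Fin q))

        codes : List Code
        codes = List.map inj₁ domain ++ List.map inj₂ (cartesianProduct pairs pairs)

        -- A nontrivial collision (ξ , p), (ξ , p′) determines ξ, so p and p′ suffice.
        code : ∀ ξ (p p′ : Fin q × Fin q) → Dec (p ≡ p′) → Code
        code ξ p p′ (yes _) = inj₁ (ξ , p)
        code ξ p p′ (no _)  = inj₂ (p , p′)

        encode : (Fin q × (Fin q × Fin q)) × (Fin q × (Fin q × Fin q)) → Code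
        encode ((ξ , p) , (_ , p′)) = code ξ p p′ (≡-dec _≟_ _≟_ p p′)

        code∈ : ∀ {ξ p p′} → (ξ , p) ∈ domain → p′ ∈ pairs → ∀ p≟p′ → code ξ p p′ p≟p′ ∈ codes
        code∈ u∈ p′∈ (yes _) = ∈-++⁺ˡ (∈-map⁺ inj₁ u∈)
        code∈ u∈ p′∈ (no _)  = ∈-++⁺ʳ (List.map inj₁ domain) (∈-map⁺ inj₂
          (∈-cartesianProduct⁺ (proj₂ (∈-cartesianProduct⁻ (allFin q) pairs u∈)) p′∈))

        -- In the nontrivial case both slopes concern the same four points, so either ξ = ζ or y =
        -- y′. The latter forces x = x′, against nontriviality. The decisions are arguments so that
        -- they can be matched together with the equality of codes.
        code-injective : ∀ {ξ x y x′ y′ ζ u v u′ v′} →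
          Slope ⟦ ξ ⟧ x′ x y y′ → Slope ⟦ ζ ⟧ u′ u v v′ →
          ∀ p≟p′ r≟r′ → code ξ (x , y) (x′ , y′) p≟p′ ≡ code ζ (u , v) (u′ , v′) r≟r′ →
          (ξ ≡ ζ) × (x , y) ≡ (u , v) × (x′ , y′) ≡ (u′ , v′)
        code-injective s t (yes refl) (yes refl) refl = refl , refl , refl
        code-injective {ξ} {x} {y} {x′} {y′} {ζ} s t (no p≢p′) (no _) refl =
          [ (λ ξ≡ζ → ξ≡ζ , refl , refl)
          , (λ { refl → contradiction (cong (_, y) (sym (slope-horizontal ⟦ ξ ⟧ x′ x y s))) p≢p′ })
          ]′ (slope-unique ξ ζ x′ x y y′ s t)

        encode∈ : ∀ {w} → w ∈ collisions domain → encode w ∈ codes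
        encode∈ {(ξ , p) , (ξ′ , p′)} w∈ with u∈ , u′∈ , _ ← ∈-collisions⁻ domain w∈ =
          code∈ u∈ (proj₂ (∈-cartesianProduct⁻ (allFin q) pairs u′∈)) (≡-dec _≟_ _≟_ p p′)

        encode-injective : ∀ {w v} → w ∈ collisions domain → v ∈ collisions domain →
                           encode w ≡ encode v → w ≡ v
        encode-injective {(ξ , x , y) , (ξ′ , x′ , y′)} {(ζ , u , v) , (ζ′ , u′ , v′)} w∈ v∈ eq
          with _ , _ , w-eq ← ∈-collisions⁻ domain w∈ | _ , _ , v-eq ← ∈-collisions⁻ domain v∈
          with refl , w-slope ← collision ξ x y ξ′ x′ y′ w-eq
             | refl , v-slope ← collision ζ u v ζ′ u′ v′ v-eq
          with refl , refl , refl ← code-injective w-slope v-slope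
                 (≡-dec _≟_ _≟_ (x , y) (x′ , y′)) (≡-dec _≟_ _≟_ (u , v) (u′ , v′)) eq
          = refl

        collisions-upper-bound : length (collisions domain) ℕ.≤
          q ℕ.* (length as ℕ.* length as) ℕ.+ length as ℕ.* length as ℕ.* (length as ℕ.* length as)
        collisions-upper-bound = ℕ.≤-trans
          (length-injection encode (collisions⁺ domain-unique) encode∈ encode-injective)
          (ℕ.≤-reflexive (begin
            length codes
              ≡⟨ length-++ (List.map inj₁ domain) ⟩
            length (List.map inj₁ domain) ℕ.+ length (List.map inj₂ (cartesianProduct pairs pairs))
              ≡⟨ cong₂ ℕ._+_ (length-map inj₁ domain) (length-map inj₂ (cartesianProduct pairs pairs)) ⟩
            length domain ℕ.+ length (cartesianProduct pairs pairs)
              ≡⟨ cong₂ ℕ._+_ length-domain (length-cartesianProduct pairs pairs) ⟩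
            q ℕ.* (length as ℕ.* length as) ℕ.+ length pairs ℕ.* length pairs
              ≡⟨ cong (λ k → q ℕ.* (length as ℕ.* length as) ℕ.+ k ℕ.* k) (length-cartesianProduct as as) ⟩
            q ℕ.* (length as ℕ.* length as) ℕ.+ length as ℕ.* length as ℕ.* (length as ℕ.* length as) ∎))
          where
          open ≡-Reasoning

        -- With n = |A|² and t = |I(A)|, the two collision bounds give (q n)² ≤ q t (q n + n²), and
        -- n ≤ q bounds this by 2 q t q n. Then q n and q are cancelled.
        |A|²≤2|T| : length as ℕ.* length as ℕ.≤ q → length as ℕ.* length as ℕ.≤ 2 ℕ.* length ts
        |A|²≤2|T| a²≤q = ℕ.*-cancelˡ-≤ q (ℕ.*-cancelˡ-≤ (q ℕ.* n) (begin
          q ℕ.* n ℕ.* (q ℕ.* n)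
            ≡⟨ cong₂ ℕ._*_ length-domain length-domain ⟨
          length domain ℕ.* length domain
            ≤⟨ collisions-lower-bound (cartesianProduct (allFin q) ts) domain-unique f∈ ⟩
          length (cartesianProduct (allFin q) ts) ℕ.* length (collisions domain)
            ≡⟨ cong (ℕ._* length (collisions domain))
               (trans (length-cartesianProduct (allFin q) ts) (cong (ℕ._* t) length-allFin)) ⟩
          q ℕ.* t ℕ.* length (collisions domain)
            ≤⟨ ℕ.*-monoʳ-≤ (q ℕ.* t)
               (ℕ.≤-trans collisions-upper-bound (ℕ.+-monoʳ-≤ (q ℕ.* n) (ℕ.*-monoˡ-≤ n a²≤q))) ⟩
          q ℕ.* t ℕ.* (q ℕ.* n ℕ.+ q ℕ.* n)
            ≡⟨ identity q n t ⟩
          q ℕ.* n ℕ.* (q ℕ.* (2 ℕ.* t)) ∎))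
          where
          open ℕ.≤-Reasoning
          n = length as ℕ.* length as
          t = length ts
          instance
            a-nonZero : NonZero (length as)
            a-nonZero = ℕ.>-nonZero |A|-positive
            qn-nonZero : NonZero (q ℕ.* n)
            qn-nonZero = ℕ.m*n≢0 q n {{it}} {{ℕ.m*n≢0 (length as) (length as)}}
          identity : ∀ q n t → q ℕ.* t ℕ.* (q ℕ.* n ℕ.+ q ℕ.* n) ≡ q ℕ.* n ℕ.* (q ℕ.* (2 ℕ.* t))
          identity = ℕ-Solver.solve-∀

      -- The case of a ratio n for which n + 1 is not a ratio.

      module LastRatio {n a b c d} (a∈ : a ∈ₛ A) (b∈ : b ∈ₛ A) (c∈ : c ∈ₛ A) (d∈ : d ∈ₛ A)
                       (c≢d : c ≢ d) (ratio : Slope n a b c d) (¬ratio : ¬ Ratio (1ℤ + n)) where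

        f : Fin q × Fin q → Fin q
        f (x , y) = form a b c d x y

        f∈ : ∀ {p} → p ∈ pairs → f p ∈ ts
        f∈ p∈ with x∈ , y∈ ← ∈-cartesianProduct⁻ as as p∈ = form∈ a∈ b∈ c∈ d∈ x∈ y∈

        open Collisions _≟_ f

        collision : ∀ x y x′ y′ → f (x , y) ≡ f (x′ , y′) → Slope n x′ x y y′
        collision x y x′ y′ = form-collision n a b c d x y x′ y′ c≢d ratio

        -- The second term a₀ (a₀ - a₀) vanishes, leaving x (c - d), which is injective in x. It is
        -- treated as a form of slope 0.
        |A|≤|T| : length as ℕ.≤ length ts
        |A|≤|T| = length-injection (λ x → form a₀ a₀ c d x a₀) as-unique
          (λ x∈ → form∈ a₀∈A a₀∈A c∈ d∈ x∈ a₀∈as)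
          λ {x} {y} _ _ eq → sym (slope-horizontal 0ℤ y x a₀
            (form-collision 0ℤ a₀ a₀ c d x a₀ y a₀ c≢d (slope-0 a₀ c d) eq))
          where a₀∈A = proj₂ nonempty

        -- The extra element `z` costs a factor |A| in the domain, matched by that of `y′` in the
        -- target, so |A| cancels from the resulting bound.
        encode : Fin q × ((Fin q × Fin q) × (Fin q × Fin q)) → Fin q × (Fin q × Fin q)
        encode (z , (x , y) , (x′ , y′)) = y′ , (y -F x , x′ -F z)

        domain : List (Fin q × ((Fin q × Fin q) × (Fin q × Fin q)))
        domain = cartesianProduct as (collisions pairs)

        encode∈ : ∀ {w} → w ∈ domain → encode w ∈ cartesianProduct as (cartesianProduct ss ss)
        encode∈ {z , (x , y) , (x′ , y′)} w∈
          with z∈ , p∈ ← ∈-cartesianProduct⁻ as (collisions pairs) w∈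
          with u∈ , u′∈ , _ ← ∈-collisions⁻ pairs p∈
          with x∈ , y∈ ← ∈-cartesianProduct⁻ as as u∈ | x′∈ , y′∈ ← ∈-cartesianProduct⁻ as as u′∈ =
          ∈-cartesianProduct⁺ y′∈ (∈-cartesianProduct⁺ (difference∈ y∈ x∈) (difference∈ x′∈ z∈))

        -- If `y` and `v` differed, z - w = (n + 1) (y - v) would make n + 1 a ratio.
        successor-slope-trivial : ∀ {y z v w} → y ∈ as → z ∈ as → v ∈ as → w ∈ as →
          Slope (1ℤ + n) z w y v → y ≡ v × z ≡ w
        successor-slope-trivial {y} {z} {v} {w} y∈ z∈ v∈ w∈ p with y ≟ v
        ... | yes refl = refl , slope-horizontal (1ℤ + n) z w y p
        ... | no y≢v = contradiction
          (z , w , y , v , ∈-elements⁻ z∈ , ∈-elements⁻ w∈ , ∈-elements⁻ y∈ , ∈-elements⁻ v∈ , y≢v , p)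
          ¬ratio

        domain-slope : ∀ {z x y x′ y′} → (z , (x , y) , (x′ , y′)) ∈ domain →
                       z ∈ as × y ∈ as × Slope n x′ x y y′
        domain-slope {z} {x} {y} {x′} {y′} w∈
          with z∈ , p∈ ← ∈-cartesianProduct⁻ as (collisions pairs) w∈
          with u∈ , _ , eq ← ∈-collisions⁻ pairs p∈ =
          z∈ , proj₂ (∈-cartesianProduct⁻ as as u∈) , collision x y x′ y′ eq

        -- First `y` and `z` are recovered from the failure of n + 1 to be a ratio; then the two
        -- differences yield `x` and `x′`.
        decode : ∀ {z x y x′ y′ z₁ x₁ y₁ x₁′ y₁′} →
          z ∈ as × y ∈ as × Slope n x′ x y y′ → z₁ ∈ as × y₁ ∈ as × Slope n x₁′ x₁ y₁ y₁′ →
          y′ ≡ y₁′ → y -F x ≡ y₁ -F x₁ → x′ -F z ≡ x₁′ -F z₁ →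
          (z , (x , y) , (x′ , y′)) ≡ (z₁ , (x₁ , y₁) , (x₁′ , y₁′))
        decode {z} {x} {y} {x′} {y′} {z₁} {x₁} {y₁} {x₁′} (z∈ , y∈ , s) (z₁∈ , y₁∈ , s₁) refl d-eq d′-eq =
          conclude
            (successor-slope-trivial y∈ z∈ y₁∈ z₁∈
              (slope-successor n x y x′ y′ z x₁ y₁ x₁′ z₁ s s₁ d-eq d′-eq))
            d-eq d′-eq
          where
          conclude : y ≡ y₁ × z ≡ z₁ → y -F x ≡ y₁ -F x₁ → x′ -F z ≡ x₁′ -F z₁ →
                     (z , (x , y) , (x′ , y′)) ≡ (z₁ , (x₁ , y₁) , (x₁′ , y′))
          conclude (refl , refl) d-eq d′-eq = cong₂ (λ u u′ → z , (u , y) , (u′ , y′))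
            (-F-cancelˡ y x x₁ d-eq) (-F-cancelʳ z x′ x₁′ d′-eq)

        encode-injective : ∀ {w w₁} → w ∈ domain → w₁ ∈ domain → encode w ≡ encode w₁ → w ≡ w₁
        encode-injective w∈ w₁∈ eq = decode (domain-slope w∈) (domain-slope w₁∈)
          (,-injectiveˡ eq) (,-injectiveˡ (,-injectiveʳ eq)) (,-injectiveʳ (,-injectiveʳ eq))

        collisions-upper-bound : length (collisions pairs) ℕ.≤ length ss ℕ.* length ss
        collisions-upper-bound = ℕ.*-cancelˡ-≤ (length as) (begin
          length as ℕ.* length (collisions pairs)
            ≡⟨ length-cartesianProduct as (collisions pairs) ⟨
          length domain
            ≤⟨ length-injection encode
                 (Unique.cartesianProduct⁺ as-unique (collisions⁺ pairs-unique)) encode∈ encode-injective ⟩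
          length (cartesianProduct as (cartesianProduct ss ss))
            ≡⟨ length-cartesianProduct as (cartesianProduct ss ss) ⟩
          length as ℕ.* length (cartesianProduct ss ss)
            ≡⟨ cong (length as ℕ.*_) (length-cartesianProduct ss ss) ⟩
          length as ℕ.* (length ss ℕ.* length ss) ∎)
          where
          open ℕ.≤-Reasoning
          instance
            a-nonZero : NonZero (length as)
            a-nonZero = ℕ.>-nonZero |A|-positive

        |A|⁴≤|T||S|² : length as ℕ.* length as ℕ.* (length as ℕ.* length as) ℕ.≤
                       length ts ℕ.* (length ss ℕ.* length ss)
        |A|⁴≤|T||S|² = begin
          length as ℕ.* length as ℕ.* (length as ℕ.* length as)
            ≡⟨ cong₂ ℕ._*_ (length-cartesianProduct as as) (length-cartesianProduct as as) ⟨
          length pairs ℕ.* length pairs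
            ≤⟨ collisions-lower-bound ts pairs-unique f∈ ⟩
          length ts ℕ.* length (collisions pairs)
            ≤⟨ ℕ.*-monoʳ-≤ (length ts) collisions-upper-bound ⟩
          length ts ℕ.* (length ss ℕ.* length ss) ∎
          where open ℕ.≤-Reasoning

      -- The claim is squared to avoid the exponent 5/2. The factor 4 comes from squaring |A|² ≤ 2
      -- |I(A)|.
      |A|⁵≤4[|S||T|]² : length as ℕ.* length as ℕ.≤ q →
                        length as ℕ.^ 5 ℕ.≤ 4 ℕ.* (length ss ℕ.* length ts) ℕ.^ 2
      |A|⁵≤4[|S||T|]² a²≤q with ratio? 0ℤ
      ... | no ¬ratio₀ = begin
        length as ℕ.^ 5                       ≤⟨ ℕ.^-monoˡ-≤ 5 (¬ratio₀⇒|A|≤1 ¬ratio₀) ⟩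
        1                                     ≤⟨ ℕ.^-monoˡ-≤ 2 (ℕ.*-mono-≤ |S|-positive |T|-positive) ⟩
        (length ss ℕ.* length ts) ℕ.^ 2       ≤⟨ ℕ.m≤n*m _ 4 ⟩
        4 ℕ.* (length ss ℕ.* length ts) ℕ.^ 2 ∎
        where open ℕ.≤-Reasoning
      -- The test is on `+ toℕ ξ` rather than the opaque `⟦ ξ ⟧`, so that a failure serves as the
      -- end point of the walk along ℕ.
      ... | yes ratio₀ with all? (λ ξ → ratio? (+ toℕ ξ))
      ...   | yes ratio = begin
        length as ℕ.^ 5
          ≡⟨ identityˡ (length as) ⟩
        length as ℕ.* (length as ℕ.* length as ℕ.* (length as ℕ.* length as))
          ≤⟨ ℕ.*-mono-≤ |A|≤|S| (ℕ.*-mono-≤ |A|²≤2|T|′ |A|²≤2|T|′) ⟩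
        length ss ℕ.* (2 ℕ.* length ts ℕ.* (2 ℕ.* length ts))
          -- Since |A - A| ≥ 1, it is at most its own square.
          ≤⟨ ℕ.*-monoˡ-≤ _ (ℕ.m≤m*n (length ss) (length ss) {{ℕ.>-nonZero |S|-positive}}) ⟩
        length ss ℕ.* length ss ℕ.* (2 ℕ.* length ts ℕ.* (2 ℕ.* length ts))
          ≡⟨ identityʳ (length ss) (length ts) ⟩
        4 ℕ.* (length ss ℕ.* length ts) ℕ.^ 2 ∎
        where
        open ℕ.≤-Reasoning
        |A|²≤2|T|′ = AllRatios.|A|²≤2|T| (λ ξ → subst Ratio (sym (⟦⟧≡+toℕ ξ)) (ratio ξ)) a²≤q
        identityˡ : ∀ a → a ℕ.* (a ℕ.* (a ℕ.* (a ℕ.* (a ℕ.* 1)))) ≡ a ℕ.* (a ℕ.* a ℕ.* (a ℕ.* a))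
        identityˡ = ℕ-Solver.solve-∀
        identityʳ : ∀ s t → s ℕ.* s ℕ.* (2 ℕ.* t ℕ.* (2 ℕ.* t)) ≡ 4 ℕ.* (s ℕ.* t ℕ.* (s ℕ.* t ℕ.* 1))
        identityʳ = ℕ-Solver.solve-∀
      ...   | no ¬all with ξ , ¬ratio-ξ ← ¬∀⟶∃¬ q (λ ξ → Ratio (+ toℕ ξ)) (λ ξ → ratio? (+ toℕ ξ)) ¬all
        with n , (a , b , c , d , a∈ , b∈ , c∈ , d∈ , c≢d , r) , ¬ratioₙ₊₁
             ← last-true (λ n → ratio? (+ n)) ratio₀ (toℕ ξ) ¬ratio-ξ = begin
        length as ℕ.^ 5
          ≡⟨ identityˡ (length as) ⟩
        length as ℕ.* length as ℕ.* (length as ℕ.* length as) ℕ.* length as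
          ≤⟨ ℕ.*-mono-≤ L.|A|⁴≤|T||S|² L.|A|≤|T| ⟩
        length ts ℕ.* (length ss ℕ.* length ss) ℕ.* length ts
          ≡⟨ identityʳ (length ss) (length ts) ⟩
        (length ss ℕ.* length ts) ℕ.^ 2
          ≤⟨ ℕ.m≤n*m _ 4 ⟩
        4 ℕ.* (length ss ℕ.* length ts) ℕ.^ 2 ∎
        where
        open ℕ.≤-Reasoning
        -- With `+ n` for the slope, `1ℤ + n` computes to `+ suc n`, the index at which the walk
        -- fails.
        module L = LastRatio a∈ b∈ c∈ d∈ c≢d r ¬ratioₙ₊₁
        identityˡ : ∀ a → a ℕ.* (a ℕ.* (a ℕ.* (a ℕ.* (a ℕ.* 1)))) ≡ a ℕ.* a ℕ.* (a ℕ.* a) ℕ.* a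
        identityˡ = ℕ-Solver.solve-∀
        identityʳ : ∀ s t → t ℕ.* (s ℕ.* s) ℕ.* t ≡ s ℕ.* t ℕ.* (s ℕ.* t ℕ.* 1)
        identityʳ = ℕ-Solver.solve-∀

  |A|⁵≤4[|A-A||I|]² : ∀ {q} .{{_ : NonZero q}} → Prime q → ∀ (A S T : Subset q) → Nonempty A →
    ∣ A ∣ ℕ.^ 2 ℕ.< q → IsDiffSet A S → IsISet A T → ∣ A ∣ ℕ.^ 5 ℕ.≤ 4 ℕ.* (∣ S ∣ ℕ.* ∣ T ∣) ℕ.^ 2
  |A|⁵≤4[|A-A||I|]² {q} q-prime A S T nonempty small isD isI =
    subst₂ (λ a st → a ℕ.^ 5 ℕ.≤ 4 ℕ.* st ℕ.^ 2)
      (length-elements A) (cong₂ ℕ._*_ (length-elements S) (length-elements T))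
      (|A|⁵≤4[|S||T|]² (ℕ.≤-trans (ℕ.≤-reflexive |A|²≡) (ℕ.<⇒≤ small)))
    where
    open Slopes.Sets q-prime A S T nonempty isD isI using (|A|⁵≤4[|S||T|]²)
    |A|²≡ : length (elements A) ℕ.* length (elements A) ≡ ∣ A ∣ ℕ.^ 2
    |A|²≡ = trans (cong (λ k → k ℕ.* k) (length-elements A)) (cong (∣ A ∣ ℕ.*_) (sym (ℕ.*-identityʳ ∣ A ∣)))


-- From natural numbers to the rational inequality.

module RationalForm where

  open import Data.Nat.Base as ℕ using (ℕ)
  import Data.Nat.Properties as ℕ
  open import Data.Integer.Base as ℤ using (+_; +≤+)
  import Data.Integer.Properties as ℤ
  open import Data.Rational.Base using (toℚᵘ; ½; _/_; _*_; _≤_)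
  open import Data.Rational.Properties using (toℚᵘ-cancel-≤; toℚᵘ-homo-*; toℚᵘ-fromℚᵘ)
  open import Data.Rational.Unnormalised.Base as ℚᵘ using (mkℚᵘ; *≤*)
  import Data.Rational.Unnormalised.Properties as ℚᵘ
  open import Relation.Binary.PropositionalEquality

  ¼*-≤ : ∀ m n → m ℕ.≤ 4 ℕ.* n → ½ * ½ * ((+ m) / 1) ≤ (+ n) / 1
  ¼*-≤ m n m≤4n = toℚᵘ-cancel-≤ (begin
    toℚᵘ (½ * ½ * ((+ m) / 1))             ≃⟨ toℚᵘ-homo-* (½ * ½) ((+ m) / 1) ⟩
    toℚᵘ (½ * ½) ℚᵘ.* toℚᵘ ((+ m) / 1)     ≃⟨ ℚᵘ.*-congˡ {toℚᵘ (½ * ½)} (toℚᵘ-fromℚᵘ (mkℚᵘ (+ m) 0)) ⟩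
    -- `mkℚᵘ` stores the denominator minus one, so this factor is ¼.
    mkℚᵘ (+ 1) 3 ℚᵘ.* mkℚᵘ (+ m) 0         ≤⟨ *≤* cross ⟩
    mkℚᵘ (+ n) 0                           ≃⟨ toℚᵘ-fromℚᵘ (mkℚᵘ (+ n) 0) ⟨
    toℚᵘ ((+ n) / 1)                       ∎)
    where
    open ℚᵘ.≤-Reasoning
    cross : (+ 1 ℤ.* + m) ℤ.* + 1 ℤ.≤ + n ℤ.* + 4
    cross = subst₂ ℤ._≤_
      (sym (trans (ℤ.*-identityʳ _) (ℤ.*-identityˡ (+ m))))
      (trans (cong +_ (ℕ.*-comm 4 n)) (ℤ.pos-* n 4))
      (+≤+ m≤4n)

open import Defs
open import Data.Nat using (ℕ; NonZero; _^_; _<_)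
open import Data.Nat.Primality using (Prime)
open import Data.Fin.Subset using (Subset; ∣_∣; Nonempty)
open import Data.Integer using (+_)
open import Data.Rational using (ℚ; _/_; _*_; _≤_; 0ℚ; ½)
open import Data.Rational.Properties using (positive⁻¹)
open import Data.Product using (∃-syntax; _×_; _,_)
open RationalForm using (¼*-≤)
open DifferencesAndI using (|A|⁵≤4[|A-A||I|]²)

theorem2 : ∃[ c ] (0ℚ Data.Rational.< c ×
    ((q : ℕ) .{{_ : NonZero q}} → Prime q →
    (A S T : Subset q) → Nonempty A → ∣ A ∣ ^ 2 < q →
    IsDiffSet A S → IsISet A T →
    c * c * ((+ (∣ A ∣ ^ 5)) / 1)
    ≤ (+ ((∣ S ∣ Data.Nat.* ∣ T ∣) ^ 2)) / 1))
-- The constant ½ is chosen because its square is the inverse of the factor 4.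
theorem2 = ½ , positive⁻¹ ½ , λ q q-prime A S T nonempty small isD isI →
  ¼*-≤ (∣ A ∣ ^ 5) ((∣ S ∣ Data.Nat.* ∣ T ∣) ^ 2)
    (|A|⁵≤4[|A-A||I|]² q-prime A S T nonempty small isD isI)
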